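{- Let $p$ be an odd prime, let $1\le w<p$ be an integer and $1\le N\le p$. Let $V(w,N,p)=\#\{q_{p,w}(u) : u=0,\ldots,N-1\}$. Then $$V(w,N,p)\gg \gcd(w-1,p-1)\,\frac{N^{1/2}}{p^{4/3}},$$ with an absolute implied constant (where $\gcd(0,p-1)=p-1$ for $w=1$).
   Context: For an odd prime $p$ and an integer $w\ge1$, the polynomial quotient $q_{p,w}(u)$ of an integer $u\ge0$ is the unique integer with $0\le q_{p,w}(u)\le p-1$ and $q_{p,w}(u)\equiv \frac{u^w-u^{wp}}{p}\bmod p$. $A\gg B$ means $A\ge cB$ for some constant $c>0$. -}

module Defs where

open import Data.Nat using (ℕ; zero; suc; _^_; _*_)
import Data.Nat as ℕ
open import Data.Integer using (ℤ; +_; _-_)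
open import Data.Integer.DivMod using (_/_; _%ℕ_)
open import Data.List using (List; map; upTo; length; deduplicate)

-- Polynomial quotient q_{p,w}(u): the unique integer in [0, p-1] congruent
-- mod p to (u^w - u^{wp}) / p.  The division is exact (Fermat), so integer
-- floor division computes the true quotient.  p is written as suc k so the
-- divisor is syntactically nonzero; p = 0 never occurs (p prime).
polyQuot : ℕ → ℕ → ℕ → ℕ
polyQuot zero    w u = 0
polyQuot (suc k) w u =
  ((+ (u ^ w) - + (u ^ (w * suc k))) / (+ suc k)) %ℕ suc k

V : ℕ → ℕ → ℕ → ℕ
V w N p = length (deduplicate ℕ._≟_ (map (polyQuot p w) (upTo N)))

{-# OPTIONS --safe #-}

-- Write q(u) for the polynomial quotient and H(u) = u^w − u^{wp}, so that q(u) ≡ H(u)/p (mod p).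
-- From H(au) = a^w H(u) + u^{wp} H(a), if p² ∤ H(a) then the pair (q(u), q(au)) determines
-- u^w modulo p.  With g = gcd(w−1, p−1) and k = (p−1)/g, p−1 divides k(w−1), so u^w determines
-- u^{wk} ≡ u^k, and at most k residues share a k-th power.  The N/a numbers u with au < N
-- therefore give N/a ≤ V²k.
--
-- A suitable a = O(√p) exists: p² ∤ H(a) as soon as a ≢ a^p (mod p²), and writing p = AB + r with
-- A = ⌈√p⌉ this holds for one of A, B, r, since otherwise p = AB + r ≡ (AB)^p + r^p ≡ 0 (mod p²).
-- Then N³g⁶ ≤ a³V⁶(gk)³g³ ≤ 16p²·V⁶·p⁶.
module Submission where

open import Defs
open import Data.Nat using (ℕ; zero; suc; NonZero; z≤n; s≤s)
open import Data.Nat.GCD using (gcd; gcd[m,n]∣m; gcd[m,n]∣n)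
open import Data.Nat.Primality using (Prime; euclidsLemma; prime⇒nonZero; prime⇒nonTrivial; prime⇒irreducible)
open import Data.Product using (∃-syntax; _×_; _,_; proj₁; proj₂)

module PolynomialQuotients where

  import Data.Nat as ℕ
  import Data.Nat.Properties as ℕ
  import Data.Nat.Divisibility as ℕ
  import Data.Nat.Tactic.RingSolver as ℕ
  open import Data.Nat using (_!)
  open import Data.Nat.Combinatorics using (_C_; nCn≡1; k![n∸k]!∣n!; nCk≡n!/k![n-k]!)
  open import Data.Nat.DivMod using (m≡m%n+[m/n]*n; m%n<n; m/n*n≤m; m/n*n≡m; m/n≤m)
  open import Data.Nat.Solver using (module +-*-Solver)
  open import Data.Integer using (ℤ; +_; -_; _+_; _-_; _*_; _^_; 0ℤ; 1ℤ) renaming (∣_∣ to abs)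
  import Data.Integer.Properties as ℤ
  open import Data.Integer.DivMod using (_/_; _/ℕ_; _%_; _%ℕ_; a≡a%ℕn+[a/ℕn]*n; a≡a%n+[a/n]*n; n%d<d)
  open import Data.Integer.Divisibility.Signed
  open import Data.Integer.Tactic.RingSolver using (solve-∀)
  open import Data.Fin using (Fin; toℕ; fromℕ; inject₁) renaming (zero to fzero; suc to fsuc)
  import Data.Fin.Properties as Fin
  open import Data.Vec using (Vec; []; _∷_; replicate)
  open import Data.List using (List; []; _∷_; length; filter; upTo; map; deduplicate)
  open import Data.List.Properties using (length-map; length-upTo)
  open import Data.List.Relation.Unary.All as All using (All; []; _∷_)
  open import Data.List.Relation.Unary.AllPairs using (AllPairs; []; _∷_)
  import Data.List.Relation.Unary.AllPairs.Properties as AllPairs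
  open import Data.List.Relation.Unary.Any using (here; there)
  open import Data.List.Relation.Binary.Sublist.Propositional using (_⊆_; ⊆-trans; []; _∷_; _∷ʳ_)
  open import Data.List.Relation.Binary.Sublist.Propositional.Properties using (length-mono-≤; filter⁺; filter-⊆; All-resp-⊆)
  open import Data.List.Membership.Propositional using (_∈_)
  open import Data.List.Membership.Propositional.Properties using (∈-filter⁻; ∈-map⁺; ∈-map⁻; ∈-upTo⁺; ∈-upTo⁻; ∈-deduplicate⁺)
  open import Data.Sum as Sum using (_⊎_; inj₁; inj₂; [_,_]′)
  open import Data.Empty using (⊥; ⊥-elim)
  open import Function using (_∘_; _$_; id)
  open import Relation.Nullary using (¬_; Dec; yes; no; ¬?)
  open import Relation.Unary using (Pred; Decidable)
  open import Relation.Binary.PropositionalEquality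
  open import Algebra.Properties.Semiring.Sum ℤ.+-*-semiring using (sum; sum-init-last)
  import Algebra.Properties.Semiring.Exp ℤ.+-*-semiring as Exp
  import Algebra.Properties.Semiring.Mult ℤ.+-*-semiring as Mult
  open import Algebra.Properties.CommutativeSemiring.Binomial ℤ.+-*-commutativeSemiring using (theorem) renaming (binomialTerm to binomialTerm′)


  -- Congruences between integers.

  infix 4 _≡_[mod_]

  -- A record rather than an abbreviation of `m ∣ x - y`, so that unification can read `x` and `y`
  -- off the type.
  record _≡_[mod_] (x y m : ℤ) : Set where
    constructor congruent
    field
      difference : m ∣ x - y

  open _≡_[mod_]

  ≡mod-refl : ∀ {m} x → x ≡ x [mod m ]
  ≡mod-refl {m} x = congruent (divides 0ℤ (trans (ℤ.+-inverseʳ x) (sym (ℤ.*-zeroˡ m))))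

  ≡mod-reflexive : ∀ {m x y} → x ≡ y → x ≡ y [mod m ]
  ≡mod-reflexive {x = x} refl = ≡mod-refl x

  ≡mod-sym : ∀ {m x y} → x ≡ y [mod m ] → y ≡ x [mod m ]
  ≡mod-sym {m} {x} {y} (congruent d) = congruent (subst (m ∣_) (eq x y) (∣m⇒∣-m d))
    where
    eq : ∀ x y → - (x - y) ≡ y - x
    eq = solve-∀

  ≡mod-trans : ∀ {m x y z} → x ≡ y [mod m ] → y ≡ z [mod m ] → x ≡ z [mod m ]
  ≡mod-trans {m} {x} {y} {z} (congruent d) (congruent e) =
    congruent (subst (m ∣_) (eq x y z) (∣m∣n⇒∣m+n d e))
    where
    eq : ∀ x y z → (x - y) + (y - z) ≡ x - z
    eq = solve-∀

  ≡mod-+ : ∀ {m x y u v} → x ≡ y [mod m ] → u ≡ v [mod m ] → x + u ≡ y + v [mod m ]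
  ≡mod-+ {m} {x} {y} {u} {v} (congruent d) (congruent e) =
    congruent (subst (m ∣_) (eq x y u v) (∣m∣n⇒∣m+n d e))
    where
    eq : ∀ x y u v → (x - y) + (u - v) ≡ (x + u) - (y + v)
    eq = solve-∀

  ≡mod-* : ∀ {m x y u v} → x ≡ y [mod m ] → u ≡ v [mod m ] → x * u ≡ y * v [mod m ]
  ≡mod-* {m} {x} {y} {u} {v} (congruent d) (congruent e) =
    congruent (subst (m ∣_) (eq x y u v) (∣m∣n⇒∣m+n (∣m⇒∣m*n u d) (∣n⇒∣m*n y e)))
    where
    eq : ∀ x y u v → (x - y) * u + y * (u - v) ≡ x * u - y * v
    eq = solve-∀

  ≡mod-^ : ∀ {m x y} n → x ≡ y [mod m ] → x ^ n ≡ y ^ n [mod m ]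
  ≡mod-^ zero    d = ≡mod-refl 1ℤ
  ≡mod-^ (suc n) d = ≡mod-* d (≡mod-^ n d)

  ∣-resp-≡mod : ∀ {m x y} → x ≡ y [mod m ] → m ∣ x → m ∣ y
  ∣-resp-≡mod {m} {x} {y} (congruent d) m∣x = subst (m ∣_) (eq x y) (∣m∣n⇒∣m-n m∣x d)
    where
    eq : ∀ x y → x - (x - y) ≡ y
    eq = solve-∀

  -- Powers and the factorisation of xⁿ - yⁿ.

  pos-^ : ∀ m n → + (m ℕ.^ n) ≡ (+ m) ^ n
  pos-^ m zero    = refl
  pos-^ m (suc n) = trans (ℤ.pos-* m (m ℕ.^ n)) (cong (+ m *_) (pos-^ m n))

  ^-distribʳ-* : ∀ n x y → (x * y) ^ n ≡ x ^ n * y ^ n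
  ^-distribʳ-* zero    x y = refl
  ^-distribʳ-* (suc n) x y = trans (cong (x * y *_) (^-distribʳ-* n x y)) (eq x y (x ^ n) (y ^ n))
    where
    eq : ∀ x y a b → x * y * (a * b) ≡ x * a * (y * b)
    eq = solve-∀

  -- This is xⁿ⁻¹ + xⁿ⁻²y + ... + yⁿ⁻¹, the cofactor of x - y in xⁿ - yⁿ.
  geomSum : ℕ → ℤ → ℤ → ℤ
  geomSum zero    x y = 0ℤ
  geomSum (suc n) x y = x ^ n + y * geomSum n x y

  ^-^≡[-]*geomSum : ∀ n x y → x ^ n - y ^ n ≡ (x - y) * geomSum n x y
  ^-^≡[-]*geomSum zero    x y = sym (ℤ.*-zeroʳ (x - y))
  ^-^≡[-]*geomSum (suc n) x y = begin
    x * x ^ n - y * y ^ n                            ≡⟨ lhs x y (x ^ n) (y ^ n) ⟩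
    (x - y) * x ^ n + y * (x ^ n - y ^ n)            ≡⟨ cong (λ z → (x - y) * x ^ n + y * z) (^-^≡[-]*geomSum n x y) ⟩
    (x - y) * x ^ n + y * ((x - y) * geomSum n x y)  ≡⟨ rhs x y (x ^ n) (geomSum n x y) ⟩
    (x - y) * (x ^ n + y * geomSum n x y)            ∎
    where
    open ≡-Reasoning
    lhs : ∀ x y a b → x * a - y * b ≡ (x - y) * a + y * (a - b)
    lhs = solve-∀
    rhs : ∀ x y a s → (x - y) * a + y * ((x - y) * s) ≡ (x - y) * (a + y * s)
    rhs = solve-∀

  -- Each of the n + 1 summands becomes xⁿ once y is replaced by x. This decides whether p divides
  -- the cofactor: it does for p summands, and for w < p summands it does not when p ∤ x.
  geomSum≡n*x^[n-1] : ∀ {m x y} n → x ≡ y [mod m ] → geomSum (suc n) x y ≡ + suc n * x ^ n [mod m ]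
  geomSum≡n*x^[n-1] {m} {x} {y} zero d = ≡mod-reflexive (eq y)
    where
    eq : ∀ y → 1ℤ + y * 0ℤ ≡ 1ℤ * 1ℤ
    eq = solve-∀
  geomSum≡n*x^[n-1] {m} {x} {y} (suc n) d =
    ≡mod-trans (≡mod-+ (≡mod-refl (x ^ suc n)) (≡mod-* (≡mod-sym d) (geomSum≡n*x^[n-1] n d)))
               (≡mod-reflexive (trans (eq x (x ^ n) (+ suc n)) (cong (_* (x * x ^ n)) (sym (ℤ.pos-+ 1 (suc n))))))
    where
    eq : ∀ x a n → x * a + x * (n * a) ≡ (1ℤ + n) * (x * a)
    eq = solve-∀

  -- Divisibility by p and by p².

  euclidsLemmaℤ : ∀ {p} x y → Prime p → + p ∣ x * y → + p ∣ x ⊎ + p ∣ y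
  euclidsLemmaℤ {p} x y pr d =
    Sum.map ∣ᵤ⇒∣ ∣ᵤ⇒∣ (euclidsLemma (abs x) (abs y) pr (subst (p ℕ.∣_) (ℤ.abs-* x y) (∣⇒∣ᵤ d)))

  prime∣^⇒∣ : ∀ {p} x n → Prime p → + p ∣ x ^ n → + p ∣ x
  prime∣^⇒∣ x zero pr d = ⊥-elim (ℕ.nonTrivial⇒≢1 {{prime⇒nonTrivial pr}} (ℕ.∣1⇒≡1 (∣⇒∣ᵤ d)))
  prime∣^⇒∣ x (suc n) pr d with euclidsLemmaℤ x (x ^ n) pr d
  ... | inj₁ e = e
  ... | inj₂ e = prime∣^⇒∣ x n pr e

  p∣p² : ∀ p → p ∣ p * p
  p∣p² p = divides p refl

  -- Euclid's lemma is used twice: on x·y to get x = qp, then, after cancelling one p, on q·y.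
  p²∣xy⇒p²∣x : ∀ {p} x y → Prime p → ¬ (+ p ∣ y) → + p * + p ∣ x * y → + p * + p ∣ x
  p²∣xy⇒p²∣x {p} x y pr ∤y d = [ divisible , ⊥-elim ∘ ∤y ]′
    (euclidsLemmaℤ x y pr (∣-trans {+ p} {+ p * + p} {x * y} (p∣p² (+ p)) d))
    where
    eq : ∀ q p y → q * p * y ≡ p * (q * y)
    eq = solve-∀
    divisible : + p ∣ x → + p * + p ∣ x
    divisible (divides q x≡q*p) = [ finish , ⊥-elim ∘ ∤y ]′ (euclidsLemmaℤ q y pr p∣qy)
      where
      p∣qy : + p ∣ q * y
      p∣qy = *-cancelˡ-∣ (+ p) {+ p} {q * y} {{prime⇒nonZero pr}}
        (subst (+ p * + p ∣_) (trans (cong (_* y) x≡q*p) (eq q (+ p) y)) d)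
      finish : + p ∣ q → + p * + p ∣ x
      finish e = subst (+ p * + p ∣_) (sym x≡q*p) (*-monoˡ-∣ (+ p) {+ p} {q} e)

  -- Binomial coefficients modulo p and Fermat's little theorem.

  prime∤! : ∀ {p} n → Prime p → n ℕ.< p → ¬ (p ℕ.∣ n !)
  prime∤! zero pr _ d = ℕ.nonTrivial⇒≢1 {{prime⇒nonTrivial pr}} (ℕ.∣1⇒≡1 d)
  prime∤! (suc n) pr n<p d with euclidsLemma (suc n) (n !) pr d
  ... | inj₁ e = ℕ.>⇒∤ n<p e
  ... | inj₂ e = prime∤! n pr (ℕ.<-trans (ℕ.n<1+n n) n<p) e

  prime∣! : ∀ {p} → Prime p → p ℕ.∣ p !
  prime∣! {zero}  ()
  prime∣! {suc n} pr = ℕ.m∣m*n (n !)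

  nCk*k![n∸k]!≡n! : ∀ {n k} → k ℕ.≤ n → (n C k) ℕ.* (k ! ℕ.* (n ℕ.∸ k) !) ≡ n !
  nCk*k![n∸k]!≡n! {n} {k} k≤n =
    trans (cong (ℕ._* (k ! ℕ.* (n ℕ.∸ k) !)) (nCk≡n!/k![n-k]! k≤n)) (m/n*n≡m (k![n∸k]!∣n! k≤n))
    where instance _ = k ℕ.!* (n ℕ.∸ k) !≢0

  -- The prime divides p! = C(p,k)·k!·(p - k)!, but neither factorial, since both are products of
  -- numbers below p.
  prime∣C : ∀ {p} k → Prime p → 0 ℕ.< k → k ℕ.< p → p ℕ.∣ (p C k)
  prime∣C {p} k pr 0<k k<p =
    [ (λ p∣C → p∣C)
    , (λ p∣k![p∸k]! → ⊥-elim ([ prime∤! k pr k<p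
                              , prime∤! (p ℕ.∸ k) pr (ℕ.∸-monoʳ-< {p} {k} {0} 0<k (ℕ.<⇒≤ k<p))
                              ]′ (euclidsLemma (k !) ((p ℕ.∸ k) !) pr p∣k![p∸k]!)))
    ]′ (euclidsLemma (p C k) (k ! ℕ.* (p ℕ.∸ k) !) pr
         (subst (p ℕ.∣_) (sym (nCk*k![n∸k]!≡n! (ℕ.<⇒≤ k<p))) (prime∣! pr)))

  ∣-sum : ∀ {m n} (t : Fin n → ℤ) → (∀ i → m ∣ t i) → m ∣ sum t
  ∣-sum {m} {zero}  t d = divides 0ℤ (sym (ℤ.*-zeroˡ m))
  ∣-sum {m} {suc n} t d = ∣m∣n⇒∣m+n (d fzero) (∣-sum (t ∘ fsuc) (d ∘ fsuc))

  -- The binomial theorem speaks of powers and multiples in a general semiring; this and `×≡*`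
  -- translate them to ℤ.
  Exp^≡^ : ∀ x n → x Exp.^ n ≡ x ^ n
  Exp^≡^ x zero    = refl
  Exp^≡^ x (suc n) = cong (x *_) (Exp^≡^ x n)

  ×≡* : ∀ n x → n Mult.× x ≡ + n * x
  ×≡* zero    x = sym (ℤ.*-zeroˡ x)
  ×≡* (suc n) x = trans (cong (_+_ x) (×≡* n x)) (sym (ℤ.suc-* (+ n) x))

  freshmansDream : ∀ {p} x y → Prime p → (x + y) ^ p ≡ x ^ p + y ^ p [mod + p ]
  freshmansDream {p@(suc n)} x y pr = subst (λ z → z ≡ x ^ p + y ^ p [mod + p ]) (sym expansion)
    (congruent $ subst (+ p ∣_) (eq (y ^ p) (sum middle) (x ^ p)) (∣-sum middle p∣middle))
    where
    binomialTerm = binomialTerm′ x y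
    middle : Fin n → ℤ
    -- As i runs through `Fin n` with n = p - 1, these indices run through 1, ..., p - 1, leaving
    -- out both ends of the expansion.
    middle i = binomialTerm p (fsuc (inject₁ i))
    term≡ : ∀ i → binomialTerm p i ≡ + (p C toℕ i) * (x ^ toℕ i * y ^ (p ℕ.∸ toℕ i))
    term≡ i = trans (×≡* (p C toℕ i) _) (cong (+ (p C toℕ i) *_) (cong₂ _*_ (Exp^≡^ x (toℕ i)) (Exp^≡^ y (p ℕ.∸ toℕ i))))
    p∣middle : ∀ i → + p ∣ middle i
    p∣middle i = subst (+ p ∣_) (sym (term≡ (fsuc (inject₁ i))))
      (∣m⇒∣m*n {+ p} {+ (p C suc (toℕ (inject₁ i)))} _ (∣ᵤ⇒∣
        (prime∣C (suc (toℕ (inject₁ i))) pr (s≤s z≤n)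
          (s≤s (subst (ℕ._< n) (sym (Fin.toℕ-inject₁ i)) (Fin.toℕ<n i))))))
    first : binomialTerm p fzero ≡ y ^ p
    first = trans (term≡ fzero) (eq₀ (y ^ p))
      where
      eq₀ : ∀ z → 1ℤ * (1ℤ * z) ≡ z
      eq₀ = solve-∀
    last : binomialTerm p (fsuc (fromℕ n)) ≡ x ^ p
    last = trans (term≡ (fsuc (fromℕ n))) (trans (cong f (Fin.toℕ-fromℕ (suc n)))
      (trans (cong₂ (λ a b → + a * (x ^ p * y ^ b)) (nCn≡1 p) (ℕ.n∸n≡0 p)) (eq₁ (x ^ p))))
      where
      f : ℕ → ℤ
      f j = + (p C j) * (x ^ j * y ^ (p ℕ.∸ j))
      eq₁ : ∀ z → 1ℤ * (z * 1ℤ) ≡ z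
      eq₁ = solve-∀
    expansion : (x + y) ^ p ≡ y ^ p + (sum middle + x ^ p)
    expansion = begin
      (x + y) ^ p       ≡⟨ Exp^≡^ (x + y) p ⟨
      (x + y) Exp.^ p   ≡⟨ theorem p x y ⟩
      binomialTerm p fzero + sum (binomialTerm p ∘ fsuc)
        ≡⟨ cong₂ _+_ first (trans (sum-init-last (binomialTerm p ∘ fsuc)) (cong (_+_ (sum middle)) last)) ⟩
      y ^ p + (sum middle + x ^ p) ∎
      where open ≡-Reasoning
    eq : ∀ a s b → s ≡ a + (s + b) - (b + a)
    eq = solve-∀

  -- Induction on u through (1 + u)ᵖ ≡ 1 + uᵖ.
  fermat : ∀ {p} → Prime p → ∀ u → (+ u) ^ p ≡ + u [mod + p ]
  fermat {suc n} pr zero = ≡mod-reflexive (ℤ.*-zeroˡ (0ℤ ^ n))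
  fermat {p} pr (suc u) = subst (λ z → z ^ p ≡ z [mod + p ]) (sym (ℤ.pos-+ 1 u))
    (≡mod-trans (freshmansDream 1ℤ (+ u) pr)
      (≡mod-+ (≡mod-reflexive (ℤ.^-zeroˡ p)) (fermat pr u)))

  -- Roots of monic polynomials modulo p.

  -- A vector c₀ ∷ … ∷ cₙ₋₁ stands for the monic polynomial c₀ + … + cₙ₋₁ Xⁿ⁻¹ + Xⁿ.
  eval : ∀ {n} → Vec ℤ n → ℤ → ℤ
  eval []       x = 1ℤ
  eval (c ∷ cs) x = c + x * eval cs x

  -- Horner's scheme for (P(X) - P(r))/(X - r): each coefficient is the value at r of a tail of P.
  -- The quotient is again monic, so its leading 1 stays implicit.
  syntheticDivision : ∀ {n} → Vec ℤ (suc n) → ℤ → Vec ℤ n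
  syntheticDivision (c ∷ [])         r = []
  syntheticDivision (c ∷ cs@(_ ∷ _)) r = eval cs r ∷ syntheticDivision cs r

  eval-syntheticDivision : ∀ {n} (cs : Vec ℤ (suc n)) r x →
    eval cs x - eval cs r ≡ (x - r) * eval (syntheticDivision cs r) x
  eval-syntheticDivision (c ∷ []) r x = eq c r x
    where
    eq : ∀ c r x → (c + x * 1ℤ) - (c + r * 1ℤ) ≡ (x - r) * 1ℤ
    eq = solve-∀
  eval-syntheticDivision (c ∷ cs@(_ ∷ _)) r x = begin
    (c + x * eval cs x) - (c + r * eval cs r)               ≡⟨ lhs c r x (eval cs x) (eval cs r) ⟩
    (x - r) * eval cs r + x * (eval cs x - eval cs r)       ≡⟨ cong (λ z → (x - r) * eval cs r + x * z) (eval-syntheticDivision cs r x) ⟩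
    (x - r) * eval cs r + x * ((x - r) * eval (syntheticDivision cs r) x) ≡⟨ rhs r x (eval cs r) (eval (syntheticDivision cs r) x) ⟩
    (x - r) * (eval cs r + x * eval (syntheticDivision cs r) x) ∎
    where
    open ≡-Reasoning
    lhs : ∀ c r x a b → (c + x * a) - (c + r * b) ≡ (x - r) * b + x * (a - b)
    lhs = solve-∀
    rhs : ∀ r x b s → (x - r) * b + x * ((x - r) * s) ≡ (x - r) * (b + x * s)
    rhs = solve-∀

  -- Lagrange's bound, by induction on the degree: for a further root s, p divides P(s) - P(r) = (s
  -- - r)Q(s) but not s - r, so s is a root of the quotient Q.
  ∣roots∣≤degree : ∀ {p n} → Prime p → (cs : Vec ℤ n) (rs : List ℤ) →
    AllPairs (λ r s → ¬ (r ≡ s [mod + p ])) rs → All (λ r → + p ∣ eval cs r) rs →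
    length rs ℕ.≤ n
  ∣roots∣≤degree pr cs [] _ _ = z≤n
  ∣roots∣≤degree {n = zero} pr [] (r ∷ rs) _ (p∣1 ∷ _) =
    ⊥-elim (ℕ.nonTrivial⇒≢1 {{prime⇒nonTrivial pr}} (ℕ.∣1⇒≡1 (∣⇒∣ᵤ p∣1)))
  ∣roots∣≤degree {p} {suc n} pr cs (r ∷ rs) (r≢rs ∷ distinct) (p∣r ∷ p∣rs) =
    s≤s (∣roots∣≤degree pr (syntheticDivision cs r) rs distinct
      (All.zipWith (λ (r≢s , p∣s) → root r≢s p∣s) (r≢rs , p∣rs)))
    where
    root : ∀ {s} → ¬ (r ≡ s [mod + p ]) → + p ∣ eval cs s → + p ∣ eval (syntheticDivision cs r) s
    root {s} r≢s p∣s =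
      [ (λ p∣s-r → ⊥-elim (r≢s (≡mod-sym (congruent p∣s-r)))) , (λ p∣q → p∣q) ]′
      (euclidsLemmaℤ (s - r) _ pr
        (subst (+ p ∣_) (eval-syntheticDivision cs r s) (∣m∣n⇒∣m-n p∣s p∣r)))

  eval-replicate-0 : ∀ n x → eval (replicate n 0ℤ) x ≡ x ^ n
  eval-replicate-0 zero    x = refl
  eval-replicate-0 (suc n) x =
    trans (ℤ.+-identityˡ _) (cong (x *_) (eval-replicate-0 n x))

  -- With r₀ the head of the list, all entries are roots of the monic polynomial Xⁿ⁺¹ - r₀ⁿ⁺¹.
  ∣sameNthPower∣≤n : ∀ {p} n → Prime p → (rs : List ℤ) →
    AllPairs (λ r s → ¬ (r ≡ s [mod + p ])) rs →
    (∀ {r s} → r ∈ rs → s ∈ rs → r ^ suc n ≡ s ^ suc n [mod + p ]) → length rs ℕ.≤ suc n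
  ∣sameNthPower∣≤n n pr [] _ _ = z≤n
  ∣sameNthPower∣≤n {p} n pr rs@(r₀ ∷ _) distinct same =
    ∣roots∣≤degree pr (- (r₀ ^ suc n) ∷ replicate n 0ℤ) rs distinct
      (All.tabulate λ {r} r∈rs → subst (+ p ∣_) (eq r) (difference (same r∈rs (here refl))))
    where
    eq : ∀ r → r ^ suc n - r₀ ^ suc n ≡ eval (- (r₀ ^ suc n) ∷ replicate n 0ℤ) r
    eq r = trans (ℤ.+-comm (r ^ suc n) (- (r₀ ^ suc n)))
      (cong (λ z → - (r₀ ^ suc n) + r * z) (sym (eval-replicate-0 n r)))

  -- Counting by fibres.

  module _ {a p} {A : Set a} {P : Pred A p} (P? : Decidable P) where

    length-filter+length-filter-¬ : ∀ xs →
      length xs ≡ length (filter P? xs) ℕ.+ length (filter (¬? ∘ P?) xs)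
    length-filter+length-filter-¬ [] = refl
    length-filter+length-filter-¬ (x ∷ xs) with P? x
    ... | yes _ = cong suc (length-filter+length-filter-¬ xs)
    ... | no  _ = trans (cong suc (length-filter+length-filter-¬ xs)) (sym (ℕ.+-suc _ _))

  module _ {a} {A : Set a} (f : A → ℕ) where

    fibre : ℕ → List A → List A
    fibre y = filter (λ x → f x ℕ.≟ y)

    -- Pigeonhole, by induction on `ys`: the fibre over the head is split off, and what remains is a
    -- sublist whose values lie in the tail.
    length≤length*fibre : ∀ {k} ys xs → (∀ {x} → x ∈ xs → f x ∈ ys) →
      (∀ y → length (fibre y xs) ℕ.≤ k) → length xs ℕ.≤ length ys ℕ.* k
    length≤length*fibre [] [] _ _ = z≤n
    length≤length*fibre [] (x ∷ xs) f∈ys _ with () ← f∈ys (here refl)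
    length≤length*fibre {k} (y ∷ ys) xs f∈ys fibre≤k =
      subst (ℕ._≤ k ℕ.+ length ys ℕ.* k) (sym (length-filter+length-filter-¬ y? xs))
        (ℕ.+-mono-≤ (fibre≤k y) (length≤length*fibre ys rest f∈ys′ fibre≤k′))
      where
      y? : Decidable (λ x → f x ≡ y)
      y? x = f x ℕ.≟ y
      rest = filter (¬? ∘ y?) xs
      f∈ys′ : ∀ {x} → x ∈ rest → f x ∈ ys
      f∈ys′ x∈rest with x∈xs , fx≢y ← ∈-filter⁻ (¬? ∘ y?) {xs = xs} x∈rest with f∈ys x∈xs
      ... | here fx≡y  = ⊥-elim (fx≢y fx≡y)
      ... | there fx∈ys = fx∈ys
      fibre≤k′ : ∀ z → length (fibre z rest) ℕ.≤ k
      fibre≤k′ z = ℕ.≤-trans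
        (length-mono-≤ (filter⁺ z? z? (λ { refl eq → eq }) (filter-⊆ (¬? ∘ y?) xs))) (fibre≤k z)
        where
        z? : Decidable (λ x → f x ≡ z)
        z? x = f x ℕ.≟ z

  module _ {a} {A : Set a} (f h : A → ℕ) where

    -- The fibre count is applied to `f`, then to `h` inside each fibre. Blocks are sublists of `xs`
    -- so that pairwise distinctness can be inherited from `xs`.
    length≤length²*block : ∀ {k} ys xs → (∀ {x} → x ∈ xs → f x ∈ ys) → (∀ {x} → x ∈ xs → h x ∈ ys) →
      (∀ {zs} → zs ⊆ xs → (∀ {u v} → u ∈ zs → v ∈ zs → f u ≡ f v × h u ≡ h v) → length zs ℕ.≤ k) →
      length xs ℕ.≤ length ys ℕ.* (length ys ℕ.* k)
    length≤length²*block ys xs f∈ys h∈ys block≤k =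
      length≤length*fibre f ys xs f∈ys λ y →
      length≤length*fibre h ys (fibre f y xs) (h∈ys ∘ proj₁ ∘ ∈-fibre f y xs) λ z →
      block≤k (⊆-trans (filter-⊆ (λ x → h x ℕ.≟ z) (fibre f y xs)) (filter-⊆ (λ x → f x ℕ.≟ y) xs))
        λ u∈ v∈ → let u∈f , hu≡z = ∈-fibre h z (fibre f y xs) u∈
                      v∈f , hv≡z = ∈-fibre h z (fibre f y xs) v∈
                  in trans (proj₂ (∈-fibre f y xs u∈f)) (sym (proj₂ (∈-fibre f y xs v∈f)))
                   , trans hu≡z (sym hv≡z)
      where
      ∈-fibre : ∀ (f : A → ℕ) y xs {u} → u ∈ fibre f y xs → u ∈ xs × f u ≡ y
      ∈-fibre f y xs = ∈-filter⁻ (λ x → f x ℕ.≟ y) {xs = xs}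

  AllPairs-resp-⊆ : ∀ {a ℓ} {A : Set a} {R : A → A → Set ℓ} {xs ys : List A} →
    xs ⊆ ys → AllPairs R ys → AllPairs R xs
  AllPairs-resp-⊆ []          []         = []
  AllPairs-resp-⊆ (_ ∷ʳ τ)    (_ ∷ rs)   = AllPairs-resp-⊆ τ rs
  AllPairs-resp-⊆ (refl ∷ τ)  (r ∷ rs)   = All-resp-⊆ τ r ∷ AllPairs-resp-⊆ τ rs

  -- Exact division followed by reduction.

  ∣∧<⇒≡0 : ∀ {m n} → m ℕ.∣ n → n ℕ.< m → n ≡ 0
  ∣∧<⇒≡0 {n = zero}  _ _ = refl
  ∣∧<⇒≡0 {n = suc _} m∣n n<m = ⊥-elim (ℕ.>⇒∤ n<m m∣n)

  ∣⇒≡/* : ∀ x d .{{_ : NonZero d}} → + d ∣ x → x ≡ (x / + d) * + d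
  ∣⇒≡/* x d d∣x = trans division (trans (cong (λ r → + r + (x / + d) * + d) r≡0) (ℤ.+-identityˡ _))
    where
    division : x ≡ + (x % + d) + (x / + d) * + d
    division = a≡a%n+[a/n]*n x (+ d)
    d∣r : + d ∣ + (x % + d)
    d∣r = ∣m+n∣n⇒∣m {+ d} {+ (x % + d)} {(x / + d) * + d} (subst (+ d ∣_) division d∣x) (divides (x / + d) refl)
    r≡0 : x % + d ≡ 0
    r≡0 = ∣∧<⇒≡0 (∣⇒∣ᵤ d∣r) (n%d<d x (+ d))

  -- Write x = (r + sd)d and y = (r + td)d with the common residue r; the difference is (s - t)d².
  quotient-residue-injective : ∀ x y d .{{_ : NonZero d}} → + d ∣ x → + d ∣ y →
    (x / + d) %ℕ d ≡ (y / + d) %ℕ d → x ≡ y [mod + d * + d ]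
  quotient-residue-injective x y d d∣x d∣y same =
    congruent (divides (qx - qy) (trans (cong₂ _-_ x≡ y≡) (eq (+ ((x / + d) %ℕ d)) qx qy (+ d))))
    where
    qx = (x / + d) /ℕ d
    qy = (y / + d) /ℕ d
    x≡ : x ≡ (+ ((x / + d) %ℕ d) + qx * + d) * + d
    x≡ = trans (∣⇒≡/* x d d∣x) (cong (_* + d) (a≡a%ℕn+[a/ℕn]*n (x / + d) d))
    y≡ : y ≡ (+ ((x / + d) %ℕ d) + qy * + d) * + d
    y≡ = trans (∣⇒≡/* y d d∣y) (cong (_* + d)
      (trans (a≡a%ℕn+[a/ℕn]*n (y / + d) d) (cong (λ r → + r + qy * + d) (sym same))))
    eq : ∀ r s t d → (r + s * d) * d - (r + t * d) * d ≡ (s - t) * (d * d)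
    eq = solve-∀

  -- Polynomial quotients and what a collision implies.

  numerator : ℕ → ℕ → ℕ → ℤ
  numerator p w u = (+ u) ^ w - (+ u) ^ (w ℕ.* p)

  -- Fermat's theorem for the base uʷ. It makes the division by p in `polyQuot` exact.
  fermat-^ : ∀ {p} → Prime p → ∀ w u → (+ u) ^ w ≡ (+ u) ^ (w ℕ.* p) [mod + p ]
  fermat-^ {p} pr w u = subst₂ (_≡_[mod + p ]) (pos-^ u w)
    (trans (cong (_^ p) (pos-^ u w)) (ℤ.^-*-assoc (+ u) w p)) (≡mod-sym (fermat pr (u ℕ.^ w)))

  polyQuot-injective-mod-p² : ∀ {p} → Prime p → ∀ w u v → polyQuot p w u ≡ polyQuot p w v →
    numerator p w u ≡ numerator p w v [mod + p * + p ]
  polyQuot-injective-mod-p² {zero} ()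
  polyQuot-injective-mod-p² {p@(suc _)} pr w u v same =
    subst₂ (_≡_[mod + p * + p ]) (cast u) (cast v)
      (quotient-residue-injective _ _ p (p∣ u) (p∣ v) same)
    where
    cast : ∀ u → + (u ℕ.^ w) - + (u ℕ.^ (w ℕ.* p)) ≡ numerator p w u
    cast u = cong₂ _-_ (pos-^ u w) (pos-^ u (w ℕ.* p))
    p∣ : ∀ u → + p ∣ + (u ℕ.^ w) - + (u ℕ.^ (w ℕ.* p))
    p∣ u = subst (+ p ∣_) (sym (cast u)) (difference (fermat-^ pr w u))

  numerator-* : ∀ p w a u → numerator p w (a ℕ.* u) ≡ (+ a) ^ w * numerator p w u + (+ u) ^ (w ℕ.* p) * numerator p w a
  numerator-* p w a u = trans (cong₂ _-_ (pow w) (pow (w ℕ.* p))) (eq ((+ a) ^ w) ((+ u) ^ w) _ _)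
    where
    pow : ∀ n → (+ (a ℕ.* u)) ^ n ≡ (+ a) ^ n * (+ u) ^ n
    pow n = trans (cong (_^ n) (ℤ.pos-* a u)) (^-distribʳ-* n (+ a) (+ u))
    eq : ∀ a u a′ u′ → a * u - a′ * u′ ≡ a * (u - u′) + u′ * (a - a′)
    eq = solve-∀

  -- Subtracting the product formulas for au and av leaves p² ∣ H(a)(uʷᵖ - vʷᵖ). If p did not divide
  -- the second factor, p² would divide H(a). Fermat then replaces the exponent wp by w.
  collision⇒^w≡ : ∀ {p} → Prime p → ∀ w a u v → ¬ (+ p * + p ∣ numerator p w a) →
    polyQuot p w u ≡ polyQuot p w v → polyQuot p w (a ℕ.* u) ≡ polyQuot p w (a ℕ.* v) →
    (+ u) ^ w ≡ (+ v) ^ w [mod + p ]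
  collision⇒^w≡ {p} pr w a u v p²∤Ha same same* with + p ∣? ((+ u) ^ (w ℕ.* p) - (+ v) ^ (w ℕ.* p))
  ... | yes d = ≡mod-trans (fermat-^ pr w u) (≡mod-trans (congruent d) (≡mod-sym (fermat-^ pr w v)))
  ... | no ∤d = ⊥-elim (p²∤Ha (p²∣xy⇒p²∣x (numerator p w a) (uᵖ - vᵖ) pr ∤d
      (subst (+ p * + p ∣_) (eq ((+ a) ^ w) (numerator p w u) (numerator p w v) uᵖ vᵖ (numerator p w a))
        (∣m∣n⇒∣m-n (subst (+ p * + p ∣_) (cong₂ _-_ (numerator-* p w a u) (numerator-* p w a v))
                     (difference (polyQuot-injective-mod-p² pr w (a ℕ.* u) (a ℕ.* v) same*)))
                   (∣n⇒∣m*n ((+ a) ^ w) (difference (polyQuot-injective-mod-p² pr w u v same)))))))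
    where
    uᵖ = (+ u) ^ (w ℕ.* p)
    vᵖ = (+ v) ^ (w ℕ.* p)
    eq : ∀ a hu hv u v ha → (a * hu + u * ha) - (a * hv + v * ha) - a * (hu - hv) ≡ ha * (u - v)
    eq = solve-∀

  -- Each step trades uᵖ for u. The exponent stays positive, so u divisible by p is covered as well.
  ^-reduce : ∀ {q} → Prime (suc q) → ∀ u k m → (+ u) ^ (suc k ℕ.+ m ℕ.* q) ≡ (+ u) ^ suc k [mod + suc q ]
  ^-reduce pr u k zero = ≡mod-reflexive (cong ((+ u) ^_) (ℕ.+-identityʳ (suc k)))
  ^-reduce {q} pr u k (suc m) = ≡mod-trans
    (≡mod-reflexive (trans (cong ((+ u) ^_) (eq q k (m ℕ.* q))) (ℤ.^-distribˡ-+-* (+ u) (suc q) (k ℕ.+ m ℕ.* q))))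
    (≡mod-trans (≡mod-* (fermat pr u) (≡mod-refl ((+ u) ^ (k ℕ.+ m ℕ.* q)))) (^-reduce pr u k m))
    where
    eq : ∀ q k n → suc k ℕ.+ (q ℕ.+ n) ≡ suc q ℕ.+ (k ℕ.+ n)
    eq = ℕ.solve-∀

  -- For w = mg + 1 and K = `suc k` with Kg = p - 1, wK = K + m(p - 1), so raising to the power K
  -- and reducing the exponent leaves uᴷ.
  ^w≡⇒^k≡ : ∀ {q} → Prime (suc q) → ∀ u v m g k → q ≡ suc k ℕ.* g →
    (+ u) ^ suc (m ℕ.* g) ≡ (+ v) ^ suc (m ℕ.* g) [mod + suc q ] →
    (+ u) ^ suc k ≡ (+ v) ^ suc k [mod + suc q ]
  ^w≡⇒^k≡ {q} pr u v m g k q≡ d =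
    ≡mod-trans (≡mod-sym (power u)) (≡mod-trans (≡mod-^ (suc k) d) (power v))
    where
    eq : ∀ m g k → suc (m ℕ.* g) ℕ.* suc k ≡ suc k ℕ.+ m ℕ.* (suc k ℕ.* g)
    eq = ℕ.solve-∀
    power : ∀ u → ((+ u) ^ suc (m ℕ.* g)) ^ suc k ≡ (+ u) ^ suc k [mod + suc q ]
    power u = ≡mod-trans (≡mod-reflexive (trans (ℤ.^-*-assoc (+ u) (suc (m ℕ.* g)) (suc k))
        (cong ((+ u) ^_) (trans (eq m g k) (cong (λ z → suc k ℕ.+ m ℕ.* z) (sym q≡))))))
      (^-reduce pr u k m)

  -- Fixed points of the p-th power map modulo p².

  -- In xᵖ - yᵖ = (x - y)·S the prime divides x - y, and also S ≡ p·xᵖ⁻¹.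
  ^p-lift : ∀ {p} → Prime p → ∀ {x y} → x ≡ y [mod + p ] → x ^ p ≡ y ^ p [mod + p * + p ]
  ^p-lift {zero} ()
  ^p-lift {p@(suc n)} pr {x} {y} (congruent p∣x-y@(divides q x-y≡q*p)) = congruent
    (subst (+ p * + p ∣_) (sym (trans (^-^≡[-]*geomSum p x y) (cong (_* geomSum p x y) x-y≡q*p)))
      (lemma (∣-resp-≡mod (≡mod-sym (geomSum≡n*x^[n-1] n (congruent p∣x-y))) (∣m⇒∣m*n {+ p} {+ p} (x ^ n) ∣-refl))))
    where
    eq : ∀ q p r → q * p * (r * p) ≡ q * r * (p * p)
    eq = solve-∀
    lemma : ∀ {z} → + p ∣ z → + p * + p ∣ q * + p * z
    lemma (divides r z≡r*p) = divides (q * r) (trans (cong (q * + p *_) z≡r*p) (eq q (+ p) r))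

  neg-^-odd : ∀ n x → (- x) ^ suc (n ℕ.* 2) ≡ - (x ^ suc (n ℕ.* 2))
  neg-^-odd zero    x = eq x
    where
    eq : ∀ x → - x * 1ℤ ≡ - (x * 1ℤ)
    eq = solve-∀
  neg-^-odd (suc n) x = trans (cong (λ z → - x * (- x * z)) (neg-^-odd n x)) (eq x (x ^ suc (n ℕ.* 2)))
    where
    eq : ∀ x z → - x * (- x * (- z)) ≡ - (x * (x * z))
    eq = solve-∀

  prime>2⇒odd : ∀ {p} → Prime p → 2 ℕ.< p → ∃[ n ] p ≡ suc (n ℕ.* 2)
  prime>2⇒odd {p} pr 2<p with p ℕ.% 2 | m≡m%n+[m/n]*n p 2 | m%n<n p 2
  ... | 0 | p≡ | _ = ⊥-elim ([ (λ ()) , ℕ.<⇒≢ 2<p ]′ (prime⇒irreducible pr (ℕ.divides (p ℕ./ 2) p≡)))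
  ... | 1 | p≡ | _ = p ℕ./ 2 , p≡
  ... | suc (suc _) | _ | s≤s (s≤s ())

  -- For p ∤ x this says that the Fermat quotient of x vanishes modulo p. It is closed under
  -- products, and its failure under sums is what gets exploited.
  Fixed : ℕ → ℕ → Set
  Fixed p x = + x ≡ (+ x) ^ p [mod + p * + p ]

  Fixed-0 : ∀ {p} → Prime p → Fixed p 0
  Fixed-0 {zero}  ()
  Fixed-0 {suc n} _ = ≡mod-reflexive (sym (ℤ.*-zeroˡ (0ℤ ^ n)))

  Fixed-* : ∀ p x y → Fixed p x → Fixed p y → Fixed p (x ℕ.* y)
  Fixed-* p x y fx fy = subst₂ (_≡_[mod + p * + p ]) (sym (ℤ.pos-* x y))
    (trans (sym (^-distribʳ-* p (+ x) (+ y))) (cong (_^ p) (sym (ℤ.pos-* x y)))) (≡mod-* fx fy)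

  -- x ≡ −y (mod p) gives xᵖ ≡ −yᵖ (mod p²), so p = x + y ≡ xᵖ + yᵖ ≡ 0 (mod p²).
  ¬Fixed-complement : ∀ {p} → Prime p → 2 ℕ.< p → ∀ x y → x ℕ.+ y ≡ p → Fixed p x → Fixed p y → ⊥
  ¬Fixed-complement {p} pr 2<p x y x+y≡p fx fy = ℕ.>⇒∤ {p} {p ℕ.* p} {{prime⇒nonZero pr}}
      (ℕ.m<m*n p p {{prime⇒nonZero pr}} (ℕ.<-trans (ℕ.n<1+n 1) 2<p))
      (subst (ℕ._∣ p) (ℤ.abs-* (+ p) (+ p)) (∣⇒∣ᵤ p²∣p))
    where
    odd = proj₁ (prime>2⇒odd pr 2<p)
    p≡odd = proj₂ (prime>2⇒odd pr 2<p)
    +x+y≡p : + x + + y ≡ + p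
    +x+y≡p = trans (sym (ℤ.pos-+ x y)) (cong +_ x+y≡p)
    x≡-y : + x ≡ - (+ y) [mod + p ]
    x≡-y = congruent (divides 1ℤ (trans (eq (+ x) (+ y)) (trans +x+y≡p (sym (ℤ.*-identityˡ (+ p))))))
      where
      eq : ∀ x y → x - (- y) ≡ x + y
      eq = solve-∀
    neg^p : (- (+ y)) ^ p ≡ - ((+ y) ^ p)
    neg^p = subst (λ n → (- (+ y)) ^ n ≡ - ((+ y) ^ n)) (sym p≡odd) (neg-^-odd odd (+ y))
    xᵖ+yᵖ≡0 : (+ x) ^ p + (+ y) ^ p ≡ 0ℤ [mod + p * + p ]
    xᵖ+yᵖ≡0 = ≡mod-trans (≡mod-+ (≡mod-trans (^p-lift pr x≡-y) (≡mod-reflexive neg^p)) (≡mod-refl ((+ y) ^ p)))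
      (≡mod-reflexive (ℤ.+-inverseˡ ((+ y) ^ p)))
    p²∣p : + p * + p ∣ + p
    p²∣p = subst (+ p * + p ∣_) (ℤ.+-identityʳ (+ p)) (difference
      (≡mod-trans (≡mod-reflexive (sym +x+y≡p)) (≡mod-trans (≡mod-+ fx fy) xᵖ+yᵖ≡0)))

  -- H(a) = aʷ - (aᵖ)ʷ = (a - aᵖ)·S with S ≡ w·aʷ⁻¹ (mod p). For 0 < a < p and 0 < w < p, S is prime
  -- to p, so a factor p² of H(a) would divide a - aᵖ.
  ¬Fixed⇒p²∤numerator : ∀ {p} → Prime p → ∀ n a → suc n ℕ.< p → a ℕ.< p → ¬ Fixed p a →
    ¬ (+ p * + p ∣ numerator p (suc n) a)
  ¬Fixed⇒p²∤numerator pr n zero w<p a<p ¬fixed _ = ¬fixed (Fixed-0 pr)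
  ¬Fixed⇒p²∤numerator {p} pr n a@(suc _) w<p a<p ¬fixed p²∣H =
    ¬fixed (congruent (p²∣xy⇒p²∣x (+ a - (+ a) ^ p) (geomSum w (+ a) ((+ a) ^ p)) pr p∤geomSum
      (subst (+ p * + p ∣_) factor p²∣H)))
    where
    w = suc n
    factor : numerator p w a ≡ (+ a - (+ a) ^ p) * geomSum w (+ a) ((+ a) ^ p)
    factor = trans (cong (_-_ ((+ a) ^ w)) (trans (cong ((+ a) ^_) (ℕ.*-comm w p)) (sym (ℤ.^-*-assoc (+ a) p w))))
      (^-^≡[-]*geomSum w (+ a) ((+ a) ^ p))
    p∤geomSum : ¬ (+ p ∣ geomSum w (+ a) ((+ a) ^ p))
    p∤geomSum d =
      [ (λ p∣w → ℕ.>⇒∤ w<p (∣⇒∣ᵤ p∣w)) , (λ p∣aⁿ → ℕ.>⇒∤ a<p (∣⇒∣ᵤ (prime∣^⇒∣ (+ a) n pr p∣aⁿ))) ]′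
      (euclidsLemmaℤ (+ w) ((+ a) ^ n) pr (∣-resp-≡mod (geomSum≡n*x^[n-1] n (≡mod-sym (fermat pr a))) d))

  -- A multiplier of size O(√p).

  floorSqrt : ∀ n → ∃[ s ] (s ℕ.* s ℕ.≤ n × n ℕ.< suc s ℕ.* suc s)
  floorSqrt zero = 0 , z≤n , s≤s z≤n
  floorSqrt (suc n) with s , s²≤n , n<[s+1]² ← floorSqrt n with suc n ℕ.<? suc s ℕ.* suc s
  ... | yes p = s , ℕ.m≤n⇒m≤1+n s²≤n , p
  ... | no ¬p = suc s , ℕ.≮⇒≥ ¬p , ℕ.≤-<-trans n<[s+1]² (ℕ.*-mono-< (ℕ.n<1+n (suc s)) (ℕ.n<1+n (suc s)))

  Fixed? : ∀ p x → Dec (Fixed p x)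
  Fixed? p x with (+ p * + p) ∣? (+ x - (+ x) ^ p)
  ... | yes d = yes (congruent d)
  ... | no ¬d = no (¬d ∘ difference)

  smallNonFixed : ∀ {p} → Prime p → 2 ℕ.< p → ∃[ a ] (a ℕ.< p × a ℕ.* a ℕ.≤ 4 ℕ.* p × ¬ Fixed p a)
  smallNonFixed {p@(suc n)} pr 2<p@(s≤s 2≤n) with floorSqrt n
  ... | zero , _ , n<1 = ⊥-elim (ℕ.<⇒≱ 2<p (ℕ.m≤n⇒m≤1+n n<1))
  -- The root is taken of n = p - 1, so that A = s + 1 has A² ≥ p; this gives B = ⌊p/A⌋ ≤ A.
  ... | s@(suc s-1) , s²≤n , n<A² = search
    where
    A = suc s
    B = p ℕ./ A
    r = p ℕ.% A
    s<n : s ℕ.< n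
    s<n = bound s-1 s²≤n
      where
      bound : ∀ t → suc t ℕ.* suc t ℕ.≤ n → suc t ℕ.< n
      -- For s = 1 the inequality s² ≤ n is too weak, and p > 2 is needed; for s ≥ 2, s < s²
      -- suffices.
      bound zero    _   = 2≤n
      bound (suc t) t²≤ = ℕ.<-≤-trans (ℕ.m<m*n (suc (suc t)) (suc (suc t)) (s≤s (s≤s z≤n))) t²≤
    A²≤4p : A ℕ.* A ℕ.≤ 4 ℕ.* p
    A²≤4p = begin
      A ℕ.* A                     ≤⟨ ℕ.*-mono-≤ A≤2s A≤2s ⟩
      (s ℕ.+ s) ℕ.* (s ℕ.+ s)     ≡⟨ eq s ⟩
      4 ℕ.* (s ℕ.* s)             ≤⟨ ℕ.*-monoʳ-≤ 4 (ℕ.m≤n⇒m≤1+n s²≤n) ⟩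
      4 ℕ.* p                     ∎
      where
      open ℕ.≤-Reasoning
      -- Since s ≥ 1, A = s + 1 is at most 2s; the constant 4 comes from here.
      A≤2s : A ℕ.≤ s ℕ.+ s
      A≤2s = ℕ.+-monoˡ-≤ s (s≤s z≤n)
      eq : ∀ s → (s ℕ.+ s) ℕ.* (s ℕ.+ s) ≡ 4 ℕ.* (s ℕ.* s)
      eq = ℕ.solve-∀
    small : ∀ {a} → a ℕ.≤ A → a ℕ.< p × a ℕ.* a ℕ.≤ 4 ℕ.* p
    small a≤A = ℕ.≤-<-trans a≤A (s≤s s<n) , ℕ.≤-trans (ℕ.*-mono-≤ a≤A a≤A) A²≤4p
    B≤A : B ℕ.≤ A
    B≤A = ℕ.*-cancelʳ-≤ B A A (ℕ.≤-trans (m/n*n≤m p A) n<A²)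
    witness : ∀ {a} → a ℕ.≤ A → ¬ Fixed p a → ∃[ a ] (a ℕ.< p × a ℕ.* a ℕ.≤ 4 ℕ.* p × ¬ Fixed p a)
    witness {a} a≤A ¬f = a , proj₁ (small a≤A) , proj₂ (small a≤A) , ¬f
    search : ∃[ a ] (a ℕ.< p × a ℕ.* a ℕ.≤ 4 ℕ.* p × ¬ Fixed p a)
    search with Fixed? p A | Fixed? p B | Fixed? p r
    ... | no ¬f | _     | _     = witness ℕ.≤-refl ¬f
    ... | yes _ | no ¬f | _     = witness B≤A ¬f
    ... | yes _ | yes _ | no ¬f = witness (ℕ.<⇒≤ (m%n<n p A)) ¬f
    -- Here BA is fixed as a product, so r and BA would be two fixed numbers with sum p.
    ... | yes fA | yes fB | yes fr =
      ⊥-elim (¬Fixed-complement pr 2<p r (B ℕ.* A) (sym (m≡m%n+[m/n]*n p A)) fr (Fixed-* p B A fB fA))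

  -- The count and the final inequality.

  <p⇒incongruent : ∀ {p i j} → i ℕ.< j → j ℕ.< p → ¬ (+ i ≡ + j [mod + p ])
  <p⇒incongruent {p} {i} {j} i<j j<p i≡j = ℕ.>⇒∤ {{ℕ.>-nonZero (ℕ.m<n⇒0<n∸m i<j)}} (ℕ.≤-<-trans (ℕ.m∸n≤m j i) j<p)
    (∣⇒∣ᵤ (subst (+ p ∣_) (trans (ℤ.m-n≡m⊖n j i) (ℤ.⊖-≥ (ℕ.<⇒≤ i<j))) (difference (≡mod-sym i≡j))))

  -- The pairs (q(u), q(au)) for u < M take at most V² values, and numbers sharing a pair share a
  -- `suc k`-th power. M ≤ N ≤ p keeps the u pairwise incongruent.
  count≤V²k : ∀ {q} → Prime (suc q) → ∀ N M a m g k → (∀ {u} → u ℕ.< M → a ℕ.* u ℕ.< N) → M ℕ.≤ N → N ℕ.≤ suc q →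
    q ≡ suc k ℕ.* g → ¬ (+ suc q * + suc q ∣ numerator (suc q) (suc (m ℕ.* g)) a) →
    M ℕ.≤ V (suc (m ℕ.* g)) N (suc q) ℕ.* (V (suc (m ℕ.* g)) N (suc q) ℕ.* suc k)
  count≤V²k {q} pr N M a m g k au<N M≤N N≤p q≡ p²∤Ha =
    subst (ℕ._≤ length values ℕ.* (length values ℕ.* suc k)) (length-upTo M)
      (length≤length²*block Q Qa values (upTo M)
        (λ u∈ → value (ℕ.<-≤-trans (∈-upTo⁻ u∈) M≤N)) (λ u∈ → value (au<N (∈-upTo⁻ u∈))) block≤k)
    where
    p = suc q
    w = suc (m ℕ.* g)
    Q Qa : ℕ → ℕ
    Q u = polyQuot p w u
    Qa u = polyQuot p w (a ℕ.* u)
    values = deduplicate ℕ._≟_ (map (polyQuot p w) (upTo N))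
    value : ∀ {u} → u ℕ.< N → polyQuot p w u ∈ values
    value u<N = ∈-deduplicate⁺ ℕ._≟_ (∈-map⁺ (polyQuot p w) (∈-upTo⁺ u<N))
    incongruent : AllPairs (λ u v → ¬ (+ u ≡ + v [mod + p ])) (upTo M)
    incongruent = AllPairs.applyUpTo⁺₁ id M
      λ i<j j<M → <p⇒incongruent i<j (ℕ.<-≤-trans j<M (ℕ.≤-trans M≤N N≤p))
    block≤k : ∀ {zs} → zs ⊆ upTo M → (∀ {u v} → u ∈ zs → v ∈ zs → Q u ≡ Q v × Qa u ≡ Qa v) →
      length zs ℕ.≤ suc k
    block≤k {zs} zs⊆ same = subst (ℕ._≤ suc k) (length-map +_ zs)
      (∣sameNthPower∣≤n k pr (map +_ zs) (AllPairs.map⁺ (AllPairs-resp-⊆ zs⊆ incongruent)) samePower)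
      where
      samePower : ∀ {r s} → r ∈ map +_ zs → s ∈ map +_ zs → r ^ suc k ≡ s ^ suc k [mod + p ]
      samePower r∈ s∈ with u , u∈ , refl ← ∈-map⁻ +_ r∈ | v , v∈ , refl ← ∈-map⁻ +_ s∈ =
        let Qu≡Qv , Qau≡Qav = same u∈ v∈
        in ^w≡⇒^k≡ pr u v m g k q≡ (collision⇒^w≡ pr w a u v p²∤Ha Qu≡Qv Qau≡Qav)

  combineBounds : ∀ p q N M a v g k → q ℕ.≤ p → q ≡ suc k ℕ.* g → N ℕ.≤ M ℕ.* a → M ℕ.≤ v ℕ.* (v ℕ.* suc k) →
    1 ℕ.≤ a → a ℕ.* a ℕ.≤ 4 ℕ.* p → g ℕ.^ 6 ℕ.* N ℕ.^ 3 ℕ.≤ 16 ℕ.* (v ℕ.^ 6 ℕ.* p ℕ.^ 8)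
  combineBounds p q N M a v g k q≤p q≡ N≤Ma M≤v²k 1≤a a²≤4p = begin
    g ℕ.^ 6 ℕ.* N ℕ.^ 3
      ≤⟨ ℕ.*-monoʳ-≤ (g ℕ.^ 6) (ℕ.^-monoˡ-≤ 3 (ℕ.≤-trans N≤Ma (ℕ.*-monoˡ-≤ a M≤v²k))) ⟩
    g ℕ.^ 6 ℕ.* (v ℕ.* (v ℕ.* suc k) ℕ.* a) ℕ.^ 3
      -- One g³ is joined with `suc k` cubed to form (p - 1)³; the other is bounded by p³.
      ≡⟨ regroup g v k a ⟩
    (g ℕ.^ 3 ℕ.* (suc k ℕ.* g) ℕ.^ 3) ℕ.* (v ℕ.^ 6 ℕ.* a ℕ.^ 3)
      ≤⟨ ℕ.*-mono-≤ (ℕ.*-mono-≤ (ℕ.^-monoˡ-≤ 3 g≤p) (ℕ.^-monoˡ-≤ 3 (subst (ℕ._≤ p) q≡ q≤p))) (ℕ.*-monoʳ-≤ (v ℕ.^ 6) a³≤16p²) ⟩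
    (p ℕ.^ 3 ℕ.* p ℕ.^ 3) ℕ.* (v ℕ.^ 6 ℕ.* (4 ℕ.* p) ℕ.^ 2)
      ≡⟨ collect p v ⟩
    16 ℕ.* (v ℕ.^ 6 ℕ.* p ℕ.^ 8) ∎
    where
    open ℕ.≤-Reasoning
    open +-*-Solver using (_:^_; _:*_; _:+_; _:=_; con)
    regroup : ∀ g v k a → g ℕ.^ 6 ℕ.* (v ℕ.* (v ℕ.* suc k) ℕ.* a) ℕ.^ 3
      ≡ (g ℕ.^ 3 ℕ.* (suc k ℕ.* g) ℕ.^ 3) ℕ.* (v ℕ.^ 6 ℕ.* a ℕ.^ 3)
    regroup = +-*-Solver.solve 4 (λ g v k a →
      g :^ 6 :* (v :* (v :* (con 1 :+ k)) :* a) :^ 3 := (g :^ 3 :* ((con 1 :+ k) :* g) :^ 3) :* (v :^ 6 :* a :^ 3)) refl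
    collect : ∀ p v → (p ℕ.^ 3 ℕ.* p ℕ.^ 3) ℕ.* (v ℕ.^ 6 ℕ.* (4 ℕ.* p) ℕ.^ 2) ≡ 16 ℕ.* (v ℕ.^ 6 ℕ.* p ℕ.^ 8)
    collect = +-*-Solver.solve 2 (λ p v →
      (p :^ 3 :* p :^ 3) :* (v :^ 6 :* (con 4 :* p) :^ 2) := con 16 :* (v :^ 6 :* p :^ 8)) refl
    g≤p : g ℕ.≤ p
    g≤p = ℕ.≤-trans (ℕ.m≤n*m g (suc k)) (subst (ℕ._≤ p) q≡ q≤p)
    -- Passing to a⁴ = (a²)² lets the bound on a² apply without square roots.
    a³≤16p² : a ℕ.^ 3 ℕ.≤ (4 ℕ.* p) ℕ.^ 2
    a³≤16p² = begin
      a ℕ.^ 3          ≤⟨ ℕ.^-monoʳ-≤ a {{ℕ.>-nonZero 1≤a}} (ℕ.n≤1+n 3) ⟩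
      a ℕ.^ 4          ≡⟨ square a ⟩
      (a ℕ.* a) ℕ.^ 2  ≤⟨ ℕ.^-monoˡ-≤ 2 a²≤4p ⟩
      (4 ℕ.* p) ℕ.^ 2  ∎
      where
      square : ∀ a → a ℕ.^ 4 ≡ (a ℕ.* a) ℕ.^ 2
      square = +-*-Solver.solve 1 (λ a → a :^ 4 := (a :* a) :^ 2) refl

  module _ (N-1 a : ℕ) .{{_ : NonZero a}} where
    private
      N = suc N-1
      -- The number ⌈N/a⌉ of u ≥ 0 with au < N; the successor accounts for u = 0.
      M = suc (N-1 ℕ./ a)

    au<N : ∀ {u} → u ℕ.< M → a ℕ.* u ℕ.< N
    au<N {u} (s≤s u≤) = s≤s (ℕ.≤-trans (ℕ.*-monoʳ-≤ a u≤)
      (subst (ℕ._≤ N-1) (ℕ.*-comm (N-1 ℕ./ a) a) (m/n*n≤m N-1 a)))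

    N≤Ma : N ℕ.≤ M ℕ.* a
    N≤Ma = subst (ℕ._< M ℕ.* a) (sym (m≡m%n+[m/n]*n N-1 a)) (ℕ.+-monoˡ-< (N-1 ℕ./ a ℕ.* a) (m%n<n N-1 a))

  bound : (p w N : ℕ) → Prime p → 2 ℕ.< p → 1 ℕ.≤ w → w ℕ.< p → 1 ℕ.≤ N → N ℕ.≤ p →
    gcd (w ℕ.∸ 1) (p ℕ.∸ 1) ℕ.^ 6 ℕ.* N ℕ.^ 3 ℕ.≤ 16 ℕ.* (V w N p ℕ.^ 6 ℕ.* p ℕ.^ 8)
  bound p@(suc q) w@(suc w-1) N@(suc N-1) pr 2<p 1≤w w<p 1≤N N≤p
    with smallNonFixed pr 2<p | gcd[m,n]∣m w-1 q | gcd[m,n]∣n w-1 q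
  ... | zero , _ , _ , ¬fixed | _ | _ = ⊥-elim (¬fixed (Fixed-0 pr))
  ... | suc _ , _ | _ | ℕ.divides zero q≡0 = ⊥-elim (ℕ.<⇒≱ 2<p (s≤s (ℕ.≤-trans (ℕ.≤-reflexive q≡0) z≤n)))
  ... | a@(suc _) , a<p , a²≤4p , ¬fixed | ℕ.divides m w-1≡ | ℕ.divides (suc k) q≡ =
    combineBounds p q N (suc (N-1 ℕ./ a)) a (V w N p) (gcd w-1 q) k (ℕ.n≤1+n q) q≡ (N≤Ma N-1 a) M≤ (s≤s z≤n) a²≤4p
    where
    M≤ : suc (N-1 ℕ./ a) ℕ.≤ V w N p ℕ.* (V w N p ℕ.* suc k)
    -- The count is stated for exponents of the form `suc (m * g)`; the divisibility g ∣ w - 1 puts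
    -- w into that form. For w = 1 this means m = 0 and g = p - 1.
    M≤ = subst (λ w → suc (N-1 ℕ./ a) ℕ.≤ V w N p ℕ.* (V w N p ℕ.* suc k)) (cong suc (sym w-1≡))
      (count≤V²k pr N _ a m (gcd w-1 q) k (au<N N-1 a) (s≤s (m/n≤m N-1 a)) N≤p q≡
        (subst (λ w → ¬ (+ p * + p ∣ numerator p w a)) (cong suc w-1≡) (¬Fixed⇒p²∤numerator pr w-1 a w<p a<p ¬fixed)))

open import Data.Nat using (_^_; _*_; _∸_; _≤_; _<_)

-- Sixth powers clear the exponents 1/2 and 4/3; an upper constant c here gives the implied constant
-- c to the power -1/6 in the bound for V.
theorem4 : ∃[ c ] (1 ≤ c × ((p w N : ℕ) → Prime p → 2 < p → 1 ≤ w → w < p → 1 ≤ N → N ≤ p →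
    gcd (w ∸ 1) (p ∸ 1) ^ 6 * N ^ 3 ≤ c * (V w N p ^ 6 * p ^ 8)))
theorem4 = 16 , s≤s z≤n , PolynomialQuotients.bound
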